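{- Let $G=(X,Y,E)$ be a finite bipartite graph, and run the following procedure on $G$. Step 1: form the graph $H$ on vertex set $X\cup Y$ whose edges are $E$ together with all pairs $\{x,x'\}$ of distinct vertices of $X$; repeatedly delete from the current graph some simple vertex (of the current graph) until either the graph has no vertices left, or the current nonempty graph has no simple vertex, in which case return False. Step 2: for each edge $e\in E$, form the graph $H_e$ on vertex set $X\cup Y$ whose edges are $E\setminus\{e\}$ together with all pairs of distinct vertices of $X$, and perform the same elimination procedure on $H_e$, returning False if at some stage the current nonempty graph has no simple vertex. If False has not been returned, return True. Then the procedure returns True if and only if $G$ is 2-chordal bipartite.
   Context: Graphs are finite and simple. For a vertex $v$ of a graph $H$, $N_H(v)$ denotes its open neighborhood and $N_H[v]=N_H(v)\cup\{v\}$ its closed neighborhood. A vertex $v$ of $H$ is simple if its neighbors $v_1,\dots,v_k$ can be ordered so that $N_H[v_{\sigma(1)}]\subseteq N_H[v_{\sigma(2)}]\subseteq\cdots\subseteq N_H[v_{\sigma(k)}]$ for some permutation $\sigma$ of $\{1,\dots,k\}$. A bipartite graph $G=(X,Y,E)$ has disjoint vertex classes $X,Y$ with every edge joining $X$ to $Y$. A chord of a cycle $C$ is an edge joining two vertices of $C$ that is not an edge of $C$. A bipartite graph is chordal bipartite if every cycle of length at least $6$ has at least one chord, and 2-chordal bipartite if every cycle of length at least $6$ has at least two chords. -}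

module Defs where

open import Data.Nat using (ℕ; zero; suc; _≤_; _<_; _∸_)
open import Data.Fin using (Fin; toℕ; _≟_)
open import Data.Bool using (Bool; true; false; _∧_; _∨_; not)
open import Data.List using (List)
open import Data.List.Membership.Propositional using (_∈_)
open import Data.List.Relation.Unary.Unique.Propositional using (Unique)
open import Data.List.Relation.Unary.Linked using (Linked)
open import Data.Product using (Σ; _×_; ∃; ∃-syntax)
open import Data.Sum using (_⊎_)
open import Relation.Nullary using (¬_)
open import Relation.Nullary.Decidable using (⌊_⌋)
open import Relation.Binary.PropositionalEquality using (_≡_; _≢_)
open import Function.Bundles using (_⇔_)

Adj : ℕ → Set
Adj n = Fin n → Fin n → Bool

IsSimpleGraph : ∀ {n} → Adj n → Set
IsSimpleGraph {n} A = (∀ u v → A u v ≡ A v u) × (∀ u → A u u ≡ false)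

-- A bipartite graph G = (X, Y, E): vertex set Fin n = X ∪ Y with
-- X = { v | side v ≡ true }, Y = { v | side v ≡ false };
-- every edge joins X to Y.
IsBipartiteGraph : ∀ {n} → (Fin n → Bool) → Adj n → Set
IsBipartiteGraph side E =
  IsSimpleGraph E × (∀ u v → E u v ≡ true → side u ≢ side v)

_==_ : ∀ {n} → Fin n → Fin n → Bool
u == v = ⌊ u ≟ v ⌋

Next : ∀ {k} → Fin k → Fin k → Set
Next {k} i j = (toℕ j ≡ suc (toℕ i)) ⊎ (toℕ i ≡ k ∸ 1 × toℕ j ≡ 0)

IsCycle : ∀ {n} → Adj n → (k : ℕ) → (Fin k → Fin n) → Set
IsCycle E k c =
  3 ≤ k × (∀ i j → c i ≡ c j → i ≡ j) × (∀ i j → Next i j → E (c i) (c j) ≡ true)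

CycleEdge : ∀ {n k} → (Fin k → Fin n) → Fin n → Fin n → Set
CycleEdge c u v =
  ∃[ i ] ∃[ j ] (Next i j × ((u ≡ c i × v ≡ c j) ⊎ (u ≡ c j × v ≡ c i)))

IsChord : ∀ {n k} → Adj n → (Fin k → Fin n) → Fin k → Fin k → Set
IsChord E c i j = toℕ i < toℕ j × E (c i) (c j) ≡ true × ¬ CycleEdge c (c i) (c j)

HasTwoChords : ∀ {n k} → Adj n → (Fin k → Fin n) → Set
HasTwoChords E c =
  ∃[ i ] ∃[ j ] ∃[ i' ] ∃[ j' ]
    (IsChord E c i j × IsChord E c i' j' × ¬ (i ≡ i' × j ≡ j'))

-- (G is bipartite by hypothesis) every cycle of length ≥ 6 has ≥ 2 chords
TwoChordal : ∀ {n} → Adj n → Set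
TwoChordal {n} E = ∀ (k : ℕ) (c : Fin k → Fin n) → 6 ≤ k → IsCycle E k c → HasTwoChords E c

-- Induced subgraphs: the current vertex set is S : Fin n → Bool.

VSet : ℕ → Set
VSet n = Fin n → Bool

InClosedNbhd : ∀ {n} → Adj n → VSet n → Fin n → Fin n → Set
InClosedNbhd A S a w = S w ≡ true × (w ≡ a ⊎ A a w ≡ true)

ClosedNbhd⊆ : ∀ {n} → Adj n → VSet n → Fin n → Fin n → Set
ClosedNbhd⊆ A S a b = ∀ w → InClosedNbhd A S a w → InClosedNbhd A S b w

IsSimpleVertex : ∀ {n} → Adj n → VSet n → Fin n → Set
IsSimpleVertex {n} A S v =
  S v ≡ true ×
  Σ (List (Fin n)) λ L →
    Unique L ×
    (∀ u → (u ∈ L) ⇔ (S u ≡ true × A v u ≡ true)) ×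
    Linked (ClosedNbhd⊆ A S) L

remove : ∀ {n} → VSet n → Fin n → VSet n
remove S v w = S w ∧ not (w == v)

IsEmpty : ∀ {n} → VSet n → Set
IsEmpty S = ∀ w → S w ≡ false

full : ∀ {n} → VSet n
full _ = true

data SomeRunEmpties {n} (A : Adj n) : VSet n → Set where
  done : ∀ {S} → IsEmpty S → SomeRunEmpties A S
  step : ∀ {S} v → IsSimpleVertex A S v → SomeRunEmpties A (remove S v) →
         SomeRunEmpties A S

data AllRunsEmpty {n} (A : Adj n) : VSet n → Set where
  done : ∀ {S} → IsEmpty S → AllRunsEmpty A S
  step : ∀ {S} → (∃[ v ] IsSimpleVertex A S v) →
         (∀ v → IsSimpleVertex A S v → AllRunsEmpty A (remove S v)) →
         AllRunsEmpty A S

H : ∀ {n} → (Fin n → Bool) → Adj n → Adj n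
H side E u v = (not (u == v) ∧ side u ∧ side v) ∨ E u v

deleteEdge : ∀ {n} → Adj n → Fin n → Fin n → Adj n
deleteEdge E a b u v = E u v ∧ not ((u == a ∧ v == b) ∨ (u == b ∧ v == a))

He : ∀ {n} → (Fin n → Bool) → Adj n → Fin n → Fin n → Adj n
He side E a b = H side (deleteEdge E a b)

ProcTrueSomeRun : ∀ {n} → (Fin n → Bool) → Adj n → Set
ProcTrueSomeRun side E =
  SomeRunEmpties (H side E) full ×
  (∀ a b → E a b ≡ true → SomeRunEmpties (He side E a b) full)

ProcTrueAllRuns : ∀ {n} → (Fin n → Bool) → Adj n → Set
ProcTrueAllRuns side E =
  AllRunsEmpty (H side E) full ×
  (∀ a b → E a b ≡ true → AllRunsEmpty (He side E a b) full)

{-# OPTIONS --safe #-}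

-- A chord of a cycle C is not an edge of C, so G is 2-chordal bipartite iff G and every G − e are chordal
-- bipartite, and it suffices to show that a bipartite F is chordal iff the graph H built from F can be eliminated.
-- If C is a chordless cycle of F of length ≥ 6, the first vertex of C to be deleted is not simple: its two
-- neighbours on C have incomparable closed neighbourhoods in H. Conversely, for chordal F each induced
-- subgraph of H has a simple vertex: if Y is nonempty, F has a nest point y ∈ Y, one for which the sets N(x) with
-- x ∈ N(y) form a chain. Nest points are found by induction in the stronger form that some nest point lies
-- outside N(x) whenever x ∈ X is not adjacent to all of Y.

module Submission where

open import Defs
open import Data.Nat using (ℕ; zero; suc; _+_; _*_; _≤_; _<_; _∸_; z≤n; s≤s)
import Data.Nat.Properties as ℕ
open import Data.Fin using (Fin; zero; suc; toℕ; fromℕ; fromℕ<; inject₁; _≟_)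
open import Data.Fin.Properties using (any?; toℕ-injective; toℕ<n; toℕ-fromℕ; toℕ-fromℕ<; toℕ-inject₁)
open import Data.Fin.Subset as Subset using (Subset; _⊂_; _⊃_; _∪_; ⁅_⁆; ∣_∣)
open import Data.Fin.Subset.Properties as Subset using (x∈p∪q⁺; x∈p∪q⁻; x∈⁅x⁆; x∈⁅y⁆⇒x≡y)
open import Data.Fin.Subset.Induction using (⊂-wellFounded; ⊃-wellFounded; Acc; acc)
open import Data.Bool using (Bool; true; false; not; _∧_; _∨_)
import Data.Bool.Properties as Bool
open import Data.List using (List; []; _∷_; length; lookup; filter; allFin)
open import Data.List.Membership.Propositional using (_∈_; _∉_; lose)
open import Data.List.Membership.Propositional.Properties using (∈-lookup; ∈-filter⁺; ∈-filter⁻; ∈-allFin)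
open import Data.List.Relation.Unary.Any as Any using (Any; here; there)
open import Data.List.Relation.Unary.All as All using (All; []; _∷_)
open import Data.List.Relation.Unary.AllPairs using (AllPairs; []; _∷_)
open import Data.List.Relation.Unary.Linked using (Linked; []; [-]; _∷_)
open import Data.List.Relation.Unary.Linked.Properties using (Linked⇒AllPairs)
open import Data.List.Relation.Unary.Unique.Propositional using (Unique)
import Data.List.Relation.Unary.Unique.Propositional.Properties as Unique
open import Data.List.Relation.Binary.Permutation.Propositional using (↭-sym; ↭⇒↭ₛ)
open import Data.List.Relation.Binary.Permutation.Propositional.Properties using (∈-resp-↭)
import Data.List.Relation.Binary.Permutation.Setoid.Properties as Permutation
import Data.List.Sort as Sort
open import Data.Product using (_×_; _,_; ∃; ∃-syntax; proj₁; proj₂)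
open import Data.Sum as Sum using (_⊎_; inj₁; inj₂; [_,_]′)
open import Data.Empty using (⊥)
open import Data.Vec using (tabulate)
open import Data.Vec.Properties using (lookup∘tabulate; lookup⇒[]=; []=⇒lookup)
open import Function using (_∘_; id)
open import Function.Bundles using (mk⇔; Equivalence)
open import Relation.Nullary using (¬_; Dec; yes; no; does; contradiction; ¬?; _×-dec_; _⊎-dec_)
open import Relation.Nullary.Decidable using (dec-true; decidable-stable; True; toWitness)
open import Relation.Unary using (Decidable)
import Relation.Binary as B
import Relation.Binary.Construct.On as On
open import Relation.Binary.PropositionalEquality using (_≡_; _≢_; refl; sym; trans; cong; cong₂; subst; setoid)
open import Relation.Binary.Definitions using (tri<; tri≈; tri>)
open import Relation.Binary.Construct.Closure.ReflexiveTransitive using (Star; ε; _◅_; _◅◅_; map; reverse)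

private
  variable
    n k : ℕ

-- Finite subsets, reachable sets and maximal candidates.

infix 4 _∈ₛ_
_∈ₛ_ : Fin n → Subset n → Set
v ∈ₛ V = v Subset.∈ V

true? : (b : Bool) → Dec (b ≡ true)
true? b = b Bool.≟ true

⟦_⟧ : {P : Fin n → Set} → Decidable P → Subset n
⟦ P? ⟧ = tabulate (does ∘ P?)

module _ {P : Fin n → Set} (P? : Decidable P) {v : Fin n} where

  ∈⟦⟧⁺ : P v → v ∈ₛ ⟦ P? ⟧
  ∈⟦⟧⁺ p = lookup⇒[]= v _ (trans (lookup∘tabulate (does ∘ P?) v) (dec-true (P? v) p))

  ∈⟦⟧⁻ : v ∈ₛ ⟦ P? ⟧ → P v
  ∈⟦⟧⁻ v∈ with P? v | trans (sym (lookup∘tabulate (does ∘ P?) v)) ([]=⇒lookup v∈)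
  ... | yes p | _ = p

module _ {R : Fin n → Fin n → Set} (R? : B.Decidable R) (s : Fin n) where

  -- Closure makes `C` large enough and the walks make it small enough: `C` is exactly the set
  -- reachable from `s`.
  IsReachableSet : Subset n → Set
  IsReachableSet C = s ∈ₛ C × (∀ {u w} → u ∈ₛ C → R u w → w ∈ₛ C) × (∀ {u} → u ∈ₛ C → Star R s u)

  abstract
    -- While some `R`-step leaves the current set, its endpoint is added; subsets of `Fin n` cannot
    -- grow forever.
    reachable : ∃ IsReachableSet
    reachable = grow ⁅ s ⁆ (⊃-wellFounded _) (x∈⁅x⁆ s) λ u∈ → subst (Star R s) (sym (x∈⁅y⁆⇒x≡y s u∈)) ε
      where
      grow : ∀ C → Acc _⊃_ C → s ∈ₛ C → (∀ {u} → u ∈ₛ C → Star R s u) → ∃ IsReachableSet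
      grow C (acc rs) s∈ walk
        with any? (λ u → any? λ w → (u Subset.∈? C) ×-dec R? u w ×-dec ¬? (w Subset.∈? C))
      ... | no ¬exit = C , s∈ , (λ {u} {w} u∈ r → decidable-stable (w Subset.∈? C) λ w∉ → ¬exit (u , w , u∈ , r , w∉)) , walk
      ... | yes (u , w , u∈ , r , w∉) =
        grow (C ∪ ⁅ w ⁆) (rs ((x∈p∪q⁺ ∘ inj₁) , w , x∈p∪q⁺ (inj₂ (x∈⁅x⁆ w)) , w∉)) (x∈p∪q⁺ (inj₁ s∈))
          λ {v} v∈ → [ walk , (λ v∈w → subst (Star R s) (sym (x∈⁅y⁆⇒x≡y w v∈w)) (walk u∈ ◅◅ r ◅ ε)) ]′ (x∈p∪q⁻ C ⁅ w ⁆ v∈)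

module _ {P : Fin n → Set} (P? : Decidable P) {T : Fin n → Fin n → Set} (T? : ∀ v → Decidable (T v)) where

  -- Inclusion-maximality of the set `T f`, phrased to hand out a witness: a candidate with a point
  -- outside `T f` must miss some point of `T f`.
  Maximal : Fin n → Set
  Maximal f = P f × (∀ {u a} → P u → T u a → ¬ T f a → ∃[ b ] (T f b × ¬ T u b))

  abstract
    maximal : ∃ P → ∃ Maximal
    maximal (v , p) = go v p (⊃-wellFounded ⟦ T? v ⟧)
      where
      go : ∀ v → P v → Acc _⊃_ ⟦ T? v ⟧ → ∃ Maximal
      go v p (acc rs) with any? (λ u → P? u ×-dec (⟦ T? v ⟧ Subset.⊂? ⟦ T? u ⟧))
      ... | yes (u , q , larger) = go u q (rs larger)
      ... | no none = v , p , private-point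
        where
        private-point : ∀ {u a} → P u → T u a → ¬ T v a → ∃[ b ] (T v b × ¬ T u b)
        private-point {u} {a} q ua va with any? (λ b → T? v b ×-dec ¬? (T? u b))
        ... | yes found = found
        ... | no ¬found = contradiction
          (u , q , (λ {b} b∈ → let vb = ∈⟦⟧⁻ (T? v) b∈ in
                      ∈⟦⟧⁺ (T? u) (decidable-stable (T? u b) λ ub → ¬found (b , vb , ub)))
                 , a , ∈⟦⟧⁺ (T? u) ua , va ∘ ∈⟦⟧⁻ (T? v)) none

-- Simple vertices

module _ (A : Adj n) (S : VSet n) where

  InClosedNbhd? : ∀ a → Decidable (InClosedNbhd A S a)
  InClosedNbhd? a w = true? (S w) ×-dec ((w ≟ a) ⊎-dec true? (A a w))

  private
    N[_] : Fin n → Subset n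
    N[ a ] = ⟦ InClosedNbhd? a ⟧

    byDegree : B.DecTotalOrder _ _ _
    byDegree = On.decTotalOrder ℕ.≤-decTotalOrder (λ a → ∣ N[ a ] ∣)

  Comparable : Fin n → Fin n → Set
  Comparable a b = ClosedNbhd⊆ A S a b ⊎ ClosedNbhd⊆ A S b a

  -- Comparable neighbourhoods are ordered by their sizes, so sorting the neighbours by degree yields the chain.
  comparable∧degree≤⇒⊆ : ∀ {a b} → Comparable a b → ∣ N[ a ] ∣ ≤ ∣ N[ b ] ∣ → ClosedNbhd⊆ A S a b
  comparable∧degree≤⇒⊆ (inj₁ a⊆b) _ = a⊆b
  comparable∧degree≤⇒⊆ {a} {b} (inj₂ b⊆a) a≤b w w∈a = decidable-stable (InClosedNbhd? b w) λ w∉b →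
    ℕ.<⇒≱ (Subset.p⊂q⇒∣p∣<∣q∣
      ((λ {z} z∈ → ∈⟦⟧⁺ (InClosedNbhd? a) (b⊆a z (∈⟦⟧⁻ (InClosedNbhd? b) z∈)))
      , w , ∈⟦⟧⁺ (InClosedNbhd? a) w∈a , w∉b ∘ ∈⟦⟧⁻ (InClosedNbhd? b))) a≤b

  linked-map-∈ : ∀ {R Q : Fin n → Fin n → Set} {L} →
                 (∀ {a b} → a ∈ L → b ∈ L → R a b → Q a b) → Linked R L → Linked Q L
  linked-map-∈ g [] = []
  linked-map-∈ g [-] = [-]
  linked-map-∈ g (r ∷ rs) = g (here refl) (there (here refl)) r ∷ linked-map-∈ (λ a∈ b∈ → g (there a∈) (there b∈)) rs

  comparable⇒simple : ∀ {v} → S v ≡ true →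
    (∀ {a b} → S a ≡ true → A v a ≡ true → S b ≡ true → A v b ≡ true → Comparable a b) →
    IsSimpleVertex A S v
  comparable⇒simple {v} Sv cmp = Sv , sort nbrs , unique , (λ u → mk⇔ (to u) (from u)) , chain
    where
    open Sort byDegree using (sort; sort-↭; sort-↗)
    nbr? : Decidable (λ u → S u ≡ true × A v u ≡ true)
    nbr? u = true? (S u) ×-dec true? (A v u)
    nbrs : List (Fin n)
    nbrs = filter nbr? (allFin n)
    to : ∀ u → u ∈ sort nbrs → S u ≡ true × A v u ≡ true
    to u u∈ = proj₂ (∈-filter⁻ nbr? {xs = allFin n} (∈-resp-↭ (sort-↭ nbrs) u∈))
    from : ∀ u → S u ≡ true × A v u ≡ true → u ∈ sort nbrs
    from u p = ∈-resp-↭ (↭-sym (sort-↭ nbrs)) (∈-filter⁺ nbr? (∈-allFin u) p)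
    unique : Unique (sort nbrs)
    unique = Permutation.Unique-resp-↭ (setoid (Fin n)) (↭⇒↭ₛ (↭-sym (sort-↭ nbrs)))
      (Unique.filter⁺ nbr? (Unique.allFin⁺ n))
    chain : Linked (ClosedNbhd⊆ A S) (sort nbrs)
    chain = linked-map-∈ (λ {a} {b} a∈ b∈ → comparable∧degree≤⇒⊆
      (let Sa , va = to a a∈; Sb , vb = to b b∈ in cmp Sa va Sb vb)) (sort-↗ nbrs)

  -- Inclusion is transitive, so the inclusions between consecutive entries of the list extend to
  -- all pairs of entries.
  simple⇒comparable : ∀ {v a b} → IsSimpleVertex A S v →
    S a ≡ true → A v a ≡ true → S b ≡ true → A v b ≡ true → Comparable a b
  simple⇒comparable {v} {a} {b} (_ , L , _ , iff , chain) Sa va Sb vb =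
    pairs (Linked⇒AllPairs (λ p q w → q w ∘ p w) chain)
      (Equivalence.from (iff a) (Sa , va)) (Equivalence.from (iff b) (Sb , vb))
    where
    pairs : ∀ {L} → AllPairs (ClosedNbhd⊆ A S) L → a ∈ L → b ∈ L → Comparable a b
    pairs (_ ∷ _) (here refl) (here refl) = inj₁ λ _ → id
    pairs (ps ∷ _) (here refl) (there b∈) = inj₁ (All.lookup ps b∈)
    pairs (ps ∷ _) (there a∈) (here refl) = inj₂ (All.lookup ps a∈)
    pairs (_ ∷ pss) (there a∈) (there b∈) = pairs pss a∈ b∈

-- Deletion of vertices and termination of runs.

module _ (S : VSet n) {v w : Fin n} where

  remove⁻ : remove S v w ≡ true → S w ≡ true × w ≢ v
  remove⁻ eq with S w | w ≟ v
  ... | true | no w≢v = refl , w≢v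

  remove⁺ : S w ≡ true → w ≢ v → remove S v w ≡ true
  remove⁺ Sw w≢v with w ≟ v
  ... | yes w≡v = contradiction w≡v w≢v
  ... | no _ rewrite Sw = refl

-- Each deletion strictly shrinks the current vertex set, so recursion along `⊂` follows every run,
-- whichever simple vertex is chosen.
allRunsEmpty : (A : Adj n) → (∀ S → ∃[ w ] S w ≡ true → ∃[ v ] IsSimpleVertex A S v) →
               ∀ S → AllRunsEmpty A S
allRunsEmpty A simple S = go S (⊂-wellFounded _)
  where
  go : ∀ S → Acc _⊂_ ⟦ true? ∘ S ⟧ → AllRunsEmpty A S
  go S (acc rs) with any? (true? ∘ S)
  ... | no ¬S = done λ w → Bool.¬-not (λ Sw → ¬S (w , Sw))
  ... | yes ne = step (simple S ne) λ v (Sv , _) → go (remove S v) (rs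
    ( (λ {w} w∈ → ∈⟦⟧⁺ (true? ∘ S) (proj₁ (remove⁻ S (∈⟦⟧⁻ (true? ∘ remove S v) w∈))))
    , v , ∈⟦⟧⁺ (true? ∘ S) Sv , λ v∈ → proj₂ (remove⁻ S (∈⟦⟧⁻ (true? ∘ remove S v) v∈)) refl))

-- Cycles

next-functional : {i j j′ : Fin k} → Next i j → Next i j′ → j ≡ j′
next-functional (inj₁ p) (inj₁ q) = toℕ-injective (trans p (sym q))
next-functional (inj₂ (_ , p)) (inj₂ (_ , q)) = toℕ-injective (trans p (sym q))
next-functional {suc k} {j = j} (inj₁ p) (inj₂ (q , _)) = contradiction (trans p (cong suc q)) (ℕ.<⇒≢ (toℕ<n j))
next-functional {suc k} {j′ = j′} (inj₂ (q , _)) (inj₁ p) = contradiction (trans p (cong suc q)) (ℕ.<⇒≢ (toℕ<n j′))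

successor : (i : Fin (suc k)) → ∃[ j ] Next i j
successor {k} i with suc (toℕ i) ℕ.<? suc k
... | yes lt = fromℕ< lt , inj₁ (toℕ-fromℕ< lt)
... | no ¬lt = zero , inj₂ (ℕ.suc-injective (ℕ.≤-antisym (toℕ<n i) (ℕ.≮⇒≥ ¬lt)) , refl)

predecessor : (i : Fin (suc k)) → ∃[ j ] Next j i
predecessor {k} zero = fromℕ k , inj₂ (toℕ-fromℕ k , refl)
predecessor (suc i) = inject₁ i , inj₁ (cong suc (sym (toℕ-inject₁ i)))

data Steps {k} : ℕ → Fin k → Fin k → Set where
  here : ∀ {i} → Steps 0 i i
  there : ∀ {m i j l} → Next i j → Steps m j l → Steps (suc m) i l

-- `q` counts the passages from the last position back to `0`, each of which contributes `k`.
steps-mod : ∀ {m} {i j : Fin k} → Steps m i j → ∃[ q ] m + toℕ i ≡ q * k + toℕ j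
steps-mod here = 0 , refl
steps-mod {k} {suc m} {i} (there {j = j} (inj₁ eq) steps) with q , ih ← steps-mod steps =
  q , trans (sym (ℕ.+-suc m (toℕ i))) (trans (cong (m +_) (sym eq)) ih)
steps-mod {suc k} {suc m} {i} {l} (there {j = j} (inj₂ (eq , eq₀)) steps) with q , ih ← steps-mod steps =
  suc q , trans (cong (suc m +_) eq) (trans (cong suc (ℕ.+-comm m k))
    (trans (cong (suc k +_) m≡) (sym (ℕ.+-assoc (suc k) (q * suc k) (toℕ l)))))
  where
  m≡ : m ≡ q * suc k + toℕ l
  m≡ = trans (sym (ℕ.+-identityʳ m)) (trans (cong (m +_) (sym eq₀)) ih)

-- A return to `i` would make `suc m` a multiple of `k`, impossible strictly between `0` and `k`.
no-return : ∀ {m} {i : Fin k} → Steps (suc m) i i → ¬ suc m < k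
no-return {k} {m} {i} steps m<k with steps-mod steps
... | q , eq with q | ℕ.+-cancelʳ-≡ (toℕ i) (suc m) (q * k) eq
... | suc q′ | m≡ = ℕ.<⇒≱ m<k (ℕ.≤-trans (ℕ.m≤m+n k (q′ * k)) (ℕ.≤-reflexive (sym m≡)))

module _ (c : Fin k → Fin n) where

  CycleEdge? : ∀ u v → Dec (CycleEdge c u v)
  CycleEdge? u v = any? λ i → any? λ j → Next? i j ×-dec
    (((u ≟ c i) ×-dec (v ≟ c j)) ⊎-dec ((u ≟ c j) ×-dec (v ≟ c i)))
    where
    Next? : ∀ (i j : Fin k) → Dec (Next i j)
    Next? i j = (toℕ j ℕ.≟ suc (toℕ i)) ⊎-dec ((toℕ i ℕ.≟ k ∸ 1) ×-dec (toℕ j ℕ.≟ 0))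

  cycleEdge⇒next : (∀ i j → c i ≡ c j → i ≡ j) → ∀ {i j} → CycleEdge c (c i) (c j) → Next i j ⊎ Next j i
  cycleEdge⇒next injective (_ , _ , i→j , inj₁ (p , q)) with refl ← injective _ _ p | refl ← injective _ _ q = inj₁ i→j
  cycleEdge⇒next injective (_ , _ , j→i , inj₂ (p , q)) with refl ← injective _ _ p | refl ← injective _ _ q = inj₂ j→i

IsChord? : (E : Adj n) (c : Fin k → Fin n) → ∀ i j → Dec (IsChord E c i j)
IsChord? E c i j = (toℕ i ℕ.<? toℕ j) ×-dec true? (E (c i) (c j)) ×-dec ¬? (CycleEdge? c (c i) (c j))

-- Induced paths

Chordal : Adj n → Set
Chordal E = ∀ k (c : Fin k → Fin _) → 6 ≤ k → IsCycle E k c → ∃[ i ] ∃[ j ] IsChord E c i j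

module _ {A : Set} where

  lookup-injective : ∀ {xs : List A} → Unique xs → ∀ i j → lookup xs i ≡ lookup xs j → i ≡ j
  lookup-injective (_ ∷ _) zero zero _ = refl
  lookup-injective (fresh ∷ _) zero (suc j) eq = contradiction eq (All.lookup fresh (∈-lookup j))
  lookup-injective (fresh ∷ _) (suc i) zero eq = contradiction (sym eq) (All.lookup fresh (∈-lookup i))
  lookup-injective (_ ∷ uniq) (suc i) (suc j) eq = cong suc (lookup-injective uniq i j eq)

  data Last (a : A) : List A → Set where
    [-] : Last a (a ∷ [])
    _∷_ : ∀ v {vs} → Last a vs → Last a (v ∷ vs)

  last-index : ∀ {a p} → Last a p → ∃[ i ] (lookup p i ≡ a × suc (toℕ i) ≡ length p)
  last-index [-] = zero , refl , refl
  last-index (v ∷ l) with i , eq , len ← last-index l = suc i , eq , cong suc len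

module BipartiteGraph {n} (side : Fin n → Bool) (F : Adj n) (bip : IsBipartiteGraph side F) where

  infix 4 _~_ _≁_ _~?_
  _~_ _≁_ : Fin n → Fin n → Set
  u ~ v = F u v ≡ true
  u ≁ v = ¬ u ~ v

  _~?_ : B.Decidable _~_
  u ~? v = true? (F u v)

  ~-sym : ∀ {u v} → u ~ v → v ~ u
  ~-sym {u} {v} = trans (proj₁ (proj₁ bip) v u)

  opposite : ∀ {u v s} → u ~ v → side u ≡ s → side v ≡ not s
  opposite {u} {v} e refl = Bool.¬-not (proj₂ bip u v e ∘ sym)

  same-side : ∀ {u v s} → side u ≡ s → side v ≡ s → u ≁ v
  same-side p q e = proj₂ bip _ _ e (trans p (sym q))

  ~⇒≢ : ∀ {u v} → u ~ v → u ≢ v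
  ~⇒≢ e refl = same-side refl refl e

  sides⇒≢ : ∀ {u v} → side u ≡ true → side v ≡ false → u ≢ v
  sides⇒≢ p q refl with () ← trans (sym p) q

  infixr 5 _⟨_⟩∷_
  data Induced : List (Fin n) → Set where
    [-] : ∀ {v} → Induced (v ∷ [])
    _⟨_⟩∷_ : ∀ {v w vs} → v ~ w → All (λ z → v ≢ z × v ≁ z) vs → Induced (w ∷ vs) → Induced (v ∷ w ∷ vs)

  induced⇒unique : ∀ {p} → Induced p → Unique p
  induced⇒unique [-] = [] ∷ []
  induced⇒unique (e ⟨ far ⟩∷ ind) = (~⇒≢ e ∷ All.map proj₁ far) ∷ induced⇒unique ind

  induced-edge : ∀ {p} → Induced p → ∀ i j → toℕ j ≡ suc (toℕ i) → lookup p i ~ lookup p j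
  induced-edge [-] zero zero ()
  induced-edge (e ⟨ _ ⟩∷ _) zero (suc zero) _ = e
  induced-edge (_ ⟨ _ ⟩∷ ind) (suc i) (suc j) eq = induced-edge ind i j (ℕ.suc-injective eq)

  induced-chordless : ∀ {p} → Induced p → ∀ i j → toℕ i < toℕ j → lookup p i ~ lookup p j → toℕ j ≡ suc (toℕ i)
  induced-chordless [-] zero zero () _
  induced-chordless (_ ⟨ _ ⟩∷ _) zero (suc zero) _ _ = refl
  induced-chordless (_ ⟨ far ⟩∷ _) zero (suc (suc j)) _ e = contradiction e (proj₂ (All.lookup far (∈-lookup j)))
  induced-chordless (_ ⟨ _ ⟩∷ ind) (suc i) (suc j) (s≤s i<j) e = cong suc (induced-chordless ind i j i<j e)

  -- Putting `x` in front closes the path to a cycle of length at least 6. The path is induced and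
  -- `x` sees only its two ends, so the cycle has no chord.
  hole : Chordal F → ∀ {x b a q} → Induced (b ∷ q) → Last a (b ∷ q) → x ~ b → x ~ a →
         All (λ z → x ≢ z × (x ~ z → z ≡ b ⊎ z ≡ a)) (b ∷ q) → 4 ≤ length q → ⊥
  hole chordal {x} {b} {a} {q} ind last x~b x~a attach long = chordless (chordal _ c (s≤s (s≤s long)) cycle)
    where
    p = b ∷ q
    c = lookup (x ∷ p)
    unique : Unique p
    unique = induced⇒unique ind
    l = proj₁ (last-index last)
    l-lookup : lookup p l ≡ a
    l-lookup = proj₁ (proj₂ (last-index last))
    l-length : suc (toℕ l) ≡ length p
    l-length = proj₂ (proj₂ (last-index last))
    edge : ∀ i j → Next i j → c i ~ c j
    edge zero (suc zero) (inj₁ _) = x~b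
    edge (suc i) (suc j) (inj₁ eq) = induced-edge ind i j (ℕ.suc-injective eq)
    edge (suc i) zero (inj₂ (eq , _)) = subst (_~ x) (sym (trans (cong (lookup p) i≡l) l-lookup)) (~-sym x~a)
      where
      i≡l : i ≡ l
      i≡l = toℕ-injective (ℕ.suc-injective (trans eq (sym l-length)))
    cycle : IsCycle F _ c
    cycle = s≤s (s≤s (ℕ.≤-trans (s≤s z≤n) long))
          , (λ i j → lookup-injective (All.map proj₁ attach ∷ unique) i j)
          , edge
    chordless : ¬ (∃[ i ] ∃[ j ] IsChord F c i j)
    -- Position `zero` is `x`; its neighbours `b` and `a` sit right after it and at the end, next to
    -- it on the cycle.
    chordless (zero , suc j , _ , e , ¬edge) with proj₂ (All.lookup attach (∈-lookup j)) e
    ... | inj₁ eq with refl ← lookup-injective unique j zero eq =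
      ¬edge (zero , suc zero , inj₁ refl , inj₁ (refl , refl))
    ... | inj₂ eq with refl ← lookup-injective unique j l (trans eq (sym l-lookup)) =
      ¬edge (suc l , zero , inj₂ (l-length , refl) , inj₂ (refl , refl))
    chordless (suc i , suc j , s≤s i<j , e , ¬edge) =
      ¬edge (suc i , suc j , inj₁ (cong suc (induced-chordless ind i j i<j e)) , inj₁ (refl , refl))

  module _ {Q : Fin n → Set} {a : Fin n} where

    -- The path is cut at the last neighbour of `v` on it: `v` has no neighbour further on, so the
    -- new list is again induced, and the end `a` is kept.
    prepend : ∀ v {p} → Induced p → Last a p → All Q p → v ∉ p → Any (v ~_) p →
              ∃[ q ] (Induced (v ∷ q) × Last a q × All Q q)
    prepend v {w ∷ vs} ind last qs v∉ hit with Any.any? (v ~?_) vs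
    prepend v (_ ⟨ _ ⟩∷ ind) (_ ∷ last) (_ ∷ qs) v∉ _ | yes hit = prepend v ind last qs (v∉ ∘ there) hit
    prepend v ind last qs v∉ (there hit) | no miss = contradiction hit miss
    prepend v ind last qs v∉ (here e) | no miss =
      _ , e ⟨ All.tabulate (λ z∈ → (λ { refl → v∉ (there z∈) }) , λ e′ → miss (lose z∈ e′)) ⟩∷ ind , last , qs

    suffix : ∀ {v p} → Induced p → Last a p → All Q p → v ∈ p →
             ∃[ q ] (Induced (v ∷ q) × Last a (v ∷ q) × All Q (v ∷ q))
    suffix ind last qs (here refl) = _ , ind , last , qs
    suffix (_ ⟨ _ ⟩∷ ind) (_ ∷ last) (_ ∷ qs) (there v∈) = suffix ind last qs v∈

    -- The walk is shortened from its end backwards: a vertex already on the path cuts it there, and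
    -- a new vertex is attached by `prepend`.
    inducedPath : ∀ {u} → Star (λ u w → u ~ w × Q u) u a → Q a →
                  ∃[ q ] (Induced (u ∷ q) × Last a (u ∷ q) × All Q (u ∷ q))
    inducedPath ε qa = [] , [-] , [-] , qa ∷ []
    inducedPath {u} ((e , qu) ◅ walk) qa with q , ind , last , qs ← inducedPath walk qa
      with Any.any? (u ≟_) (_ ∷ q)
    ... | yes u∈ = suffix ind last qs u∈
    ... | no u∉ with q′ , ind′ , last′ , qs′ ← prepend u ind last qs u∉ (here e) =
      q′ , ind′ , u ∷ last′ , qu ∷ qs′

  penultimate : ∀ {u a q} → Induced (u ∷ q) → Last a q →
                ∃[ r ] (r ∈ u ∷ q × r ~ a × All (λ z → z ~ a → z ≡ r) (u ∷ q))
  penultimate (e ⟨ _ ⟩∷ _) [-] = _ , here refl , e , (λ _ → refl) ∷ (λ e′ → contradiction refl (~⇒≢ e′)) ∷ []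
  penultimate (_ ⟨ far ⟩∷ ind@(_ ⟨ _ ⟩∷ _)) (_ ∷ last) with r , r∈ , r~a , only ← penultimate ind last =
    r , there r∈ , r~a , (λ e → contradiction e (proj₂ (All.lookup far (last∈ last)))) ∷ only
    where
    last∈ : ∀ {a q} → Last a q → a ∈ q
    last∈ [-] = here refl
    last∈ (_ ∷ l) = there (last∈ l)

  -- If f ≁ a, let r be the last vertex before a on an induced path from f to a inside C. A private neighbour b of f
  -- against r is joined to a by an induced path of length ≥ 4, which x closes to a chordless cycle.
  traceDominates : Chordal F → ∀ {x f} {C : Fin n → Set} → side x ≡ true → side f ≡ true →
    (∀ {z} → C z → x ≢ z × x ≁ z) →
    (∀ {r a} → C r → x ~ a → r ~ a → f ≁ a → ∃[ b ] (x ~ b × f ~ b × r ≁ b)) →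
    ∀ {u a} → Star (λ u w → u ~ w × C u) f u → C u → u ~ a → x ~ a → f ~ a
  traceDominates chordal {x} {f} {C} x-side f-side off private-nbr {u} {a} walk Cu u~a x~a =
    decidable-stable (f ~? a) λ f≁a → go f≁a (inducedPath (walk′ walk Cu u~a) (inj₂ refl))
    where
    Q : Fin n → Set
    Q z = C z ⊎ z ≡ a
    a-side : side a ≡ false
    a-side = opposite x~a x-side
    walk′ : ∀ {f} → Star (λ u w → u ~ w × C u) f u → C u → u ~ a → Star (λ u w → u ~ w × Q u) f a
    walk′ ε Cu u~a = (u~a , inj₁ Cu) ◅ ε
    walk′ ((e , Cv) ◅ walk) Cu u~a = (e , inj₁ Cv) ◅ walk′ walk Cu u~a
    go : f ≁ a → ∃[ q ] (Induced (f ∷ q) × Last a (f ∷ q) × All Q (f ∷ q)) → ⊥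
    go _ (_ , _ , [-] , _) = sides⇒≢ f-side a-side refl
    go f≁a (q , ind , (_ ∷ last) , qs) with r , r∈ , r~a , only ← penultimate ind last
      with All.lookup qs r∈
    ... | inj₂ refl = ~⇒≢ r~a refl
    ... | inj₁ Cr with b , x~b , f~b , r≁b ← private-nbr Cr x~a r~a f≁a =
      close (prepend b ind (f ∷ last) (All.zip (qs , only)) b∉ (here (~-sym f~b)))
      where
      b-side : side b ≡ false
      b-side = opposite x~b x-side
      b∉ : b ∉ f ∷ q
      b∉ b∈ with All.lookup qs b∈
      ... | inj₁ Cb = proj₂ (off Cb) x~b
      ... | inj₂ refl = f≁a f~b
      close : ∃[ q ] (Induced (b ∷ q) × Last a q × All (λ z → Q z × (z ~ a → z ≡ r)) q) → ⊥
      -- `b` and `a` both lie in Y, so no path joins them in 1 or 3 edges; one with 2 edges would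
      -- pass through `r`, which is not adjacent to `b`. At least 4 edges remain.
      close (_ , (e ⟨ _ ⟩∷ _) , [-] , _) = same-side b-side a-side e
      close (z ∷ _ , (e ⟨ _ ⟩∷ (e′ ⟨ _ ⟩∷ _)) , (_ ∷ [-]) , (_ , z~a⇒≡r) ∷ _) with refl ← z~a⇒≡r e′ = r≁b (~-sym e)
      close (_ , (e ⟨ _ ⟩∷ (e′ ⟨ _ ⟩∷ (e″ ⟨ _ ⟩∷ _))) , (_ ∷ (_ ∷ [-])) , _) =
        same-side (opposite e′ (opposite e b-side)) a-side e″
      close (q@(_ ∷ _ ∷ _ ∷ _ ∷ _) , ind , last@(_ ∷ (_ ∷ (_ ∷ _))) , qs) =
        hole chordal ind (b ∷ last) x~b x~a
          ((~⇒≢ x~b , λ _ → inj₁ refl) ∷ All.map (attach ∘ proj₁) qs) (s≤s (s≤s (s≤s (s≤s z≤n))))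
        where
        attach : ∀ {z} → Q z → x ≢ z × (x ~ z → z ≡ b ⊎ z ≡ a)
        attach (inj₁ Cz) = proj₁ (off Cz) , λ e → contradiction e (proj₂ (off Cz))
        attach (inj₂ refl) = ~⇒≢ x~a , λ _ → inj₂ refl

  -- Nest points

  _⊑[_]_ : Fin n → Subset n → Fin n → Set
  x ⊑[ V ] x′ = ∀ {z} → z ∈ₛ V → x ~ z → x′ ~ z

  NestPoint : Subset n → Fin n → Set
  NestPoint V y = y ∈ₛ V × side y ≡ false ×
    (∀ {x x′} → x ∈ₛ V → y ~ x → x′ ∈ₛ V → y ~ x′ → x ⊑[ V ] x′ ⊎ x′ ⊑[ V ] x)

  module Component (V : Subset n) {x y : Fin n} (y∈V : y ∈ₛ V) (x≢y : x ≢ y) (x≁y : x ≁ y) where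

    Off : Fin n → Set
    Off w = w ∈ₛ V × x ≢ w × x ≁ w

    Off? : Decidable Off
    Off? w = (w Subset.∈? V) ×-dec ¬? (x ≟ w) ×-dec ¬? (x ~? w)

    private
      component : ∃ (IsReachableSet (λ u w → (u ~? w) ×-dec Off? w) y)
      component = reachable (λ u w → (u ~? w) ×-dec Off? w) y

    C : Subset n
    C = proj₁ component

    y∈C : y ∈ₛ C
    y∈C = proj₁ (proj₂ component)

    C-closed : ∀ {u w} → u ∈ₛ C → u ~ w → Off w → w ∈ₛ C
    C-closed u∈ e off = proj₁ (proj₂ (proj₂ component)) u∈ (e , off)

    C-off : ∀ {u} → u ∈ₛ C → Off u
    C-off u∈ = end (proj₂ (proj₂ (proj₂ component)) u∈) (y∈V , x≢y , x≁y)
      where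
      end : ∀ {u v} → Star (λ u w → u ~ w × Off w) u v → Off u → Off v
      end ε off = off
      end ((_ , off) ◅ walk) _ = end walk off

    -- The walk from `y` to `u` is reversed and followed by the one from `y` to `v`; both stay in
    -- `C` because `C` is closed.
    C-connected : ∀ {u v} → u ∈ₛ C → v ∈ₛ C → Star (λ u w → u ~ w × u ∈ₛ C) u v
    C-connected u∈ v∈ = map (λ (e , u∈ , _) → e , u∈)
      (reverse (λ (e , u∈ , w∈) → ~-sym e , w∈ , u∈) (inside u∈) ◅◅ inside v∈)
      where
      go : ∀ {u v} → Star (λ u w → u ~ w × Off w) u v → u ∈ₛ C → Star (λ u w → u ~ w × u ∈ₛ C × w ∈ₛ C) u v
      go ε _ = ε
      go ((e , off) ◅ walk) u∈ = let w∈ = C-closed u∈ e off in (e , u∈ , w∈) ◅ go walk w∈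
      inside : ∀ {v} → v ∈ₛ C → Star (λ u w → u ~ w × u ∈ₛ C × w ∈ₛ C) y v
      inside v∈ = go (proj₂ (proj₂ (proj₂ component)) v∈) y∈C

  -- Induction on V. Let C be the component of y in V ∖ N[x] and f ∈ C ∩ X with N(f) ∩ N(x) maximal, so
  -- that N(f) ∩ N(x) contains every neighbour of x adjacent to C ∩ X. If f misses a vertex of C, drop x
  -- and look for a nest point outside N(f); otherwise f is adjacent to everything relevant, so drop f.
  nestPointOutside : Chordal F → ∀ {V} → Acc _⊂_ V → ∀ {x y} → x ∈ₛ V → side x ≡ true → y ∈ₛ V → side y ≡ false →
                     x ≁ y → ∃[ z ] (NestPoint V z × x ≁ z)
  nestPointOutside chordal {V} (acc rs) {x} {y} x∈ x-side y∈ y-side x≁y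
    with any? (λ u → (u Subset.∈? V) ×-dec (y ~? u))
  -- Without neighbours in `V`, `y` is vacuously a nest point.
  ... | no isolated = y , (y∈ , y-side , λ u∈ e → contradiction (_ , u∈ , e) isolated) , x≁y
  ... | yes (u , u∈ , y~u) = descend
    where
    open Component V y∈ (sides⇒≢ x-side y-side) x≁y
    -- A neighbour of a Y-vertex of `C` lies in X, so it is not adjacent to `x`; nor is it `x`
    -- itself, since `C` avoids N(x).
    nbr∈C : ∀ {z w} → z ∈ₛ C → side z ≡ false → w ∈ₛ V → z ~ w → w ∈ₛ C
    nbr∈C z∈ z-side w∈ e = C-closed z∈ e (w∈
      , (λ { refl → proj₂ (proj₂ (C-off z∈)) (~-sym e) }) , same-side x-side (opposite e z-side))
    candidate? : Decidable (λ u → u ∈ₛ C × side u ≡ true)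
    candidate? u = (u Subset.∈? C) ×-dec true? (side u)
    common? : ∀ u → Decidable (λ z → x ~ z × u ~ z)
    common? u z = (x ~? z) ×-dec (u ~? z)
    best : ∃ (Maximal candidate? common?)
    best = maximal candidate? common? (u , nbr∈C y∈C y-side u∈ y~u , opposite y~u y-side)
    f : Fin n
    f = proj₁ best
    f∈C : f ∈ₛ C
    f∈C = proj₁ (proj₁ (proj₂ best))
    f-side : side f ≡ true
    f-side = proj₂ (proj₁ (proj₂ best))
    private-nbr : ∀ {r a} → r ∈ₛ C → x ~ a → r ~ a → f ≁ a → ∃[ b ] (x ~ b × f ~ b × r ≁ b)
    private-nbr {r} r∈ x~a r~a f≁a
      with b , (x~b , f~b) , ¬common ←
        proj₂ (proj₂ best) {r} (r∈ , opposite (~-sym r~a) (opposite x~a x-side)) (x~a , r~a) (f≁a ∘ proj₂)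
      = b , x~b , f~b , λ r~b → ¬common (x~b , r~b)
    dominates : ∀ {r a} → r ∈ₛ C → r ~ a → x ~ a → f ~ a
    dominates r∈ = traceDominates chordal x-side f-side (proj₂ ∘ C-off) private-nbr (C-connected f∈C r∈) r∈
    -- By `dominates`, this set contains all neighbours in `V` of vertices of `C` in X, so
    -- inclusions between their neighbourhoods lift from the smaller set to `V`.
    Core : Fin n → Set
    Core z = z ∈ₛ V × (z ∈ₛ C ⊎ (x ~ z × f ~ z))
    Core? : Decidable Core
    Core? z = (z Subset.∈? V) ×-dec ((z Subset.∈? C) ⊎-dec ((x ~? z) ×-dec (f ~? z)))
    nbr-core : ∀ {r z} → r ∈ₛ C → side r ≡ true → z ∈ₛ V → r ~ z → Core z
    nbr-core {r} {z} r∈ r-side z∈ e with x ~? z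
    ... | yes x~z = z∈ , inj₂ (x~z , dominates r∈ e x~z)
    ... | no x≁z = z∈ , inj₁ (C-closed r∈ e (z∈ , sides⇒≢ x-side (opposite e r-side) , x≁z))
    f∈V : f ∈ₛ V
    f∈V = proj₁ (C-off f∈C)
    descend : ∃[ z ] (NestPoint V z × x ≁ z)
    descend with any? (λ z → (z Subset.∈? C) ×-dec (side z Bool.≟ false) ×-dec ¬? (f ~? z))
    -- Here `f` takes over the role of `x`. The nest point found misses `f`, so it is not a common
    -- neighbour of `x` and `f`; it lies in `C` and hence outside N(x).
    ... | yes (z , z∈ , z-side , f≁z) = dropX (nestPointOutside chordal
        (rs ((proj₁ ∘ ∈⟦⟧⁻ Core?) , x , x∈ , λ x∈W → x∉Core (proj₂ (∈⟦⟧⁻ Core? x∈W))))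
        (C⊆W f∈C) f-side (C⊆W z∈) z-side f≁z)
      where
      W : Subset n
      W = ⟦ Core? ⟧
      x∉Core : ¬ (x ∈ₛ C ⊎ (x ~ x × f ~ x))
      x∉Core (inj₁ x∈C) = proj₁ (proj₂ (C-off x∈C)) refl
      x∉Core (inj₂ (e , _)) = ~⇒≢ e refl
      C⊆W : ∀ {z} → z ∈ₛ C → z ∈ₛ W
      C⊆W z∈ = ∈⟦⟧⁺ Core? (proj₁ (C-off z∈) , inj₁ z∈)
      dropX : ∃[ z ] (NestPoint W z × f ≁ z) → ∃[ z ] (NestPoint V z × x ≁ z)
      dropX (z , (z∈W , z-side , nested) , f≁z) with ∈⟦⟧⁻ Core? z∈W
      ... | _ , inj₂ (_ , f~z) = contradiction f~z f≁z
      ... | z∈V , inj₁ z∈C = z , (z∈V , z-side , λ p∈ z~p q∈ z~q →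
          let p∈C = nbr∈C z∈C z-side p∈ z~p
              q∈C = nbr∈C z∈C z-side q∈ z~q
              lift : ∀ {p} → p ∈ₛ C → z ~ p → ∀ {v} → v ∈ₛ V → p ~ v → v ∈ₛ W
              lift p∈ z~p v∈ e = ∈⟦⟧⁺ Core? (nbr-core p∈ (opposite z~p z-side) v∈ e)
          in Sum.map (λ p⊑q v∈ e → p⊑q (lift p∈C z~p v∈ e) e) (λ q⊑p v∈ e → q⊑p (lift q∈C z~q v∈ e) e)
               (nested (C⊆W p∈C) z~p (C⊆W q∈C) z~q))
        , proj₂ (proj₂ (C-off z∈C))
    -- Now `f` is adjacent to all of `C` in Y, so its neighbourhood in `V` contains that of every
    -- X-vertex of `C`. Putting `f` back therefore preserves the chain at a nest point in `C`.
    ... | no none = dropF (nestPointOutside chordal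
        (rs (W⊆V , f , f∈V , λ f∈W → proj₁ (∈⟦⟧⁻ Rest? f∈W) refl))
        (∈⟦⟧⁺ Rest? (proj₁ (proj₂ (C-off f∈C)) ∘ sym , inj₁ refl)) x-side
        (∈⟦⟧⁺ Rest? (sides⇒≢ f-side y-side , inj₂ (y∈ , inj₁ y∈C))) y-side x≁y)
      where
      Rest? : Decidable (λ z → f ≢ z × (x ≡ z ⊎ Core z))
      Rest? z = ¬? (f ≟ z) ×-dec ((x ≟ z) ⊎-dec Core? z)
      W : Subset n
      W = ⟦ Rest? ⟧
      W⊆V : ∀ {z} → z ∈ₛ W → z ∈ₛ V
      W⊆V z∈ with ∈⟦⟧⁻ Rest? z∈
      ... | _ , inj₁ refl = x∈
      ... | _ , inj₂ (z∈V , _) = z∈V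
      f-top : ∀ {p} → p ∈ₛ C → side p ≡ true → p ⊑[ V ] f
      f-top p∈ p-side {v} v∈ e with nbr-core p∈ p-side v∈ e
      ... | _ , inj₂ (_ , f~v) = f~v
      ... | _ , inj₁ v∈C = decidable-stable (f ~? v) λ f≁v → none (v , v∈C , opposite e p-side , f≁v)
      dropF : ∃[ z ] (NestPoint W z × x ≁ z) → ∃[ z ] (NestPoint V z × x ≁ z)
      dropF (z , (z∈W , z-side , nested) , x≁z) with ∈⟦⟧⁻ Rest? z∈W
      ... | _ , inj₁ refl = contradiction refl (sides⇒≢ x-side z-side)
      ... | _ , inj₂ (_ , inj₂ (x~z , _)) = contradiction x~z x≁z
      ... | _ , inj₂ (z∈V , inj₁ z∈C) = z , (z∈V , z-side , nested′) , x≁z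
        where
        nested′ : ∀ {p q} → p ∈ₛ V → z ~ p → q ∈ₛ V → z ~ q → p ⊑[ V ] q ⊎ q ⊑[ V ] p
        nested′ {p} {q} p∈ z~p q∈ z~q
          with nbr∈C z∈C z-side p∈ z~p | nbr∈C z∈C z-side q∈ z~q | f ≟ p | f ≟ q
        ... | _ | q∈C | yes refl | _ = inj₂ (f-top q∈C (opposite z~q z-side))
        ... | p∈C | _ | no _ | yes refl = inj₁ (f-top p∈C (opposite z~p z-side))
        ... | p∈C | q∈C | no f≢p | no f≢q =
          Sum.map (λ p⊑q v∈ e → p⊑q (lift p∈C z~p v∈ e) e) (λ q⊑p v∈ e → q⊑p (lift q∈C z~q v∈ e) e)
            (nested (∈⟦⟧⁺ Rest? (f≢p , inj₂ (p∈ , inj₁ p∈C))) z~p (∈⟦⟧⁺ Rest? (f≢q , inj₂ (q∈ , inj₁ q∈C))) z~q)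
          where
          lift : ∀ {p} → p ∈ₛ C → z ~ p → ∀ {v} → v ∈ₛ V → p ~ v → v ∈ₛ W
          lift p∈ z~p v∈ e = ∈⟦⟧⁺ Rest? (sides⇒≢ f-side (opposite e (opposite z~p z-side))
            , inj₂ (nbr-core p∈ (opposite z~p z-side) v∈ e))

  -- Simple vertices of `H` from nest points of `F`.

  H⁻ : ∀ {u v} → H side F u v ≡ true → (u ≢ v × side u ≡ true × side v ≡ true) ⊎ u ~ v
  H⁻ {u} {v} eq with u ≟ v | side u | side v
  ... | yes _ | _ | _ = inj₂ eq
  ... | no _ | false | _ = inj₂ eq
  ... | no _ | true | false = inj₂ eq
  ... | no u≢v | true | true = inj₁ (u≢v , refl , refl)

  H-edge : ∀ {u v} → u ~ v → H side F u v ≡ true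
  H-edge {u} {v} e = trans (cong (_ ∨_) e) (Bool.∨-zeroʳ _)

  H-clique : ∀ {u v} → u ≢ v → side u ≡ true → side v ≡ true → H side F u v ≡ true
  H-clique {u} {v} u≢v pu pv with u ≟ v
  ... | yes u≡v = contradiction u≡v u≢v
  ... | no _ rewrite pu | pv = refl

  module _ (S : VSet n) where

    private
      V : Subset n
      V = ⟦ true? ∘ S ⟧

    -- X is a clique of `H`, so closed neighbourhoods of X-vertices can differ only in Y, where they
    -- are the neighbourhoods in `F`.
    ⊑⇒ClosedNbhd⊆ : ∀ {x x′} → side x ≡ true → side x′ ≡ true → x ⊑[ V ] x′ → ClosedNbhd⊆ (H side F) S x x′
    ⊑⇒ClosedNbhd⊆ {x} {x′} px px′ x⊑x′ w (Sw , near) = Sw , extend near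
      where
      near-x′ : side w ≡ true → w ≡ x′ ⊎ H side F x′ w ≡ true
      near-x′ pw with w ≟ x′
      ... | yes w≡x′ = inj₁ w≡x′
      ... | no w≢x′ = inj₂ (H-clique (w≢x′ ∘ sym) px′ pw)
      extend : w ≡ x ⊎ H side F x w ≡ true → w ≡ x′ ⊎ H side F x′ w ≡ true
      extend (inj₁ refl) = near-x′ px
      extend (inj₂ h) with H⁻ h
      ... | inj₁ (_ , _ , pw) = near-x′ pw
      ... | inj₂ e = inj₂ (H-edge (x⊑x′ (∈⟦⟧⁺ (true? ∘ S) Sw) e))

    -- The added edges stay inside X, so `y` has the same neighbours in `H` as in `F`, all of them
    -- in X.
    nestPoint⇒simple : ∀ {y} → NestPoint V y → IsSimpleVertex (H side F) S y
    nestPoint⇒simple {y} (y∈ , y-side , nested) =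
      comparable⇒simple (H side F) S (∈⟦⟧⁻ (true? ∘ S) y∈) λ Sa ya Sb yb →
        let a-edge = nbr ya
            b-edge = nbr yb
            a-side = opposite a-edge y-side
            b-side = opposite b-edge y-side
        in Sum.map (⊑⇒ClosedNbhd⊆ a-side b-side) (⊑⇒ClosedNbhd⊆ b-side a-side)
             (nested (∈⟦⟧⁺ (true? ∘ S) Sa) a-edge (∈⟦⟧⁺ (true? ∘ S) Sb) b-edge)
      where
      nbr : ∀ {a} → H side F y a ≡ true → y ~ a
      nbr h with H⁻ h
      ... | inj₁ (_ , py , _) = contradiction refl (sides⇒≢ py y-side)
      ... | inj₂ e = e

    chordal⇒simpleVertex : Chordal F → ∃[ w ] S w ≡ true → ∃[ v ] IsSimpleVertex (H side F) S v
    chordal⇒simpleVertex chordal (w , Sw) with any? (λ y → (y Subset.∈? V) ×-dec (side y Bool.≟ false))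
    -- Only X-vertices are left; they form a clique, in which every vertex is simple.
    ... | no noY = w , comparable⇒simple (H side F) S Sw λ Sa _ Sb _ →
      inj₁ (⊑⇒ClosedNbhd⊆ (X-only Sa) (X-only Sb) λ z∈ e →
        contradiction e (same-side (X-only Sa) (X-only (∈⟦⟧⁻ (true? ∘ S) z∈))))
      where
      X-only : ∀ {a} → S a ≡ true → side a ≡ true
      X-only Sa = Bool.¬-not λ pa → noY (_ , ∈⟦⟧⁺ (true? ∘ S) Sa , pa)
    ... | yes (y , y∈ , y-side)
      with any? (λ x → any? λ z → (x Subset.∈? V) ×-dec true? (side x) ×-dec
             (z Subset.∈? V) ×-dec (side z Bool.≟ false) ×-dec ¬? (x ~? z))
    ... | yes (x , z , x∈ , x-side , z∈ , z-side , x≁z) =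
      let v , nest , _ = nestPointOutside chordal (⊂-wellFounded V) x∈ x-side z∈ z-side x≁z
      in v , nestPoint⇒simple nest
    -- The remaining bipartite graph is complete, so all its X-vertices have the same neighbourhood
    -- and any `y` is a nest point.
    ... | no complete = y , nestPoint⇒simple (y∈ , y-side , λ {x} {x′} x∈ y~x x′∈ y~x′ →
      inj₁ λ {z} z∈ e → decidable-stable (x′ ~? z) λ x′≁z →
        complete (x′ , z , x′∈ , opposite y~x′ y-side , z∈ , opposite e (opposite y~x y-side) , x′≁z))

  -- Chordless cycles obstruct elimination.

  eliminable⇒chordal : SomeRunEmpties (H side F) full → Chordal F
  eliminable⇒chordal run k@(suc _) c 6≤k (_ , injective , edge) =
    decidable-stable (any? λ i → any? λ j → IsChord? F c i j) λ chordless → survive chordless run λ _ → refl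
    where
    module _ (chordless : ¬ (∃[ i ] ∃[ j ] IsChord F c i j)) where

      only-cycle-edges : ∀ i j → c i ~ c j → Next i j ⊎ Next j i
      only-cycle-edges i j e with ℕ.<-cmp (toℕ i) (toℕ j)
      ... | tri< i<j _ _ = cycleEdge⇒next c injective
        (decidable-stable (CycleEdge? c (c i) (c j)) λ ¬edge → chordless (i , j , i<j , e , ¬edge))
      ... | tri≈ _ i≡j _ = contradiction (cong c (toℕ-injective i≡j)) (~⇒≢ e)
      ... | tri> _ _ j<i = Sum.swap (cycleEdge⇒next c injective
        (decidable-stable (CycleEdge? c (c j) (c i)) λ ¬edge → chordless (j , i , j<i , ~-sym e , ¬edge)))

      -- For c i in X the vertex c p itself separates the two closed neighbourhoods, for c i in Y the vertex c p′ does.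
      incomparable : ∀ {S i p p′ s} → (∀ i → S (c i) ≡ true) → c i ~ c p → c i ~ c s → c p ~ c p′ →
                     p ≢ s → p′ ≢ s → ¬ Next p′ s → ¬ Next s p′ → ¬ ClosedNbhd⊆ (H side F) S (c p) (c s)
      incomparable {S} {i} {p} {p′} {s} inS ip is pp′ p≢s p′≢s ¬p′s ¬sp′ sub with side (c i) in i-side
      ... | true with proj₂ (sub (c p) (inS p , inj₁ refl))
      ...   | inj₁ eq = p≢s (injective p s eq)
      ...   | inj₂ h with H⁻ h
      ...     | inj₁ (_ , s-side , _) = sides⇒≢ s-side (opposite is i-side) refl
      ...     | inj₂ e = same-side (opposite is i-side) (opposite ip i-side) e
      incomparable {S} {i} {p} {p′} {s} inS ip is pp′ p≢s p′≢s ¬p′s ¬sp′ sub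
          | false with proj₂ (sub (c p′) (inS p′ , inj₂ (H-edge pp′)))
      ...   | inj₁ eq = p′≢s (injective p′ s eq)
      ...   | inj₂ h with H⁻ h
      ...     | inj₁ (_ , _ , p′-side) = sides⇒≢ p′-side (opposite pp′ (opposite ip i-side)) refl
      ...     | inj₂ e = [ ¬sp′ , ¬p′s ]′ (only-cycle-edges s p′ e)

      -- The positions `p′`, `p`, `i`, `s`, `s′` are consecutive; `incomparable` is applied in both
      -- directions around `i`. Any unwanted coincidence or adjacency among them would give a return
      -- after at most four steps, fewer than `k`.
      not-simple : ∀ {S} → (∀ i → S (c i) ≡ true) → ∀ i → ¬ IsSimpleVertex (H side F) S (c i)
      not-simple {S} inS i simple
        with p , p→i ← predecessor i
        with p′ , p′→p ← predecessor p
        with s , i→s ← successor i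
        with s′ , s→s′ ← successor s =
        [ incomparable inS (~-sym (edge p i p→i)) (edge i s i→s) (~-sym (edge p′ p p′→p))
            p≢s p′≢s
            (λ p′→s → p≢s (next-functional p′→p p′→s))
            (λ s→p′ → no-return (there p′→p (there p→i (there i→s (there s→p′ here)))) short)
        , incomparable inS (edge i s i→s) (~-sym (edge p i p→i)) (edge s s′ s→s′)
            (p≢s ∘ sym) (λ { refl → no-return (there p→i (there i→s (there s→s′ here))) short })
            (λ s′→p → no-return (there p→i (there i→s (there s→s′ (there s′→p here)))) short)
            (λ p→s′ → i≢s′ (next-functional p→i p→s′))
        ]′ (simple⇒comparable (H side F) S simple (inS p) (H-edge (~-sym (edge p i p→i))) (inS s) (H-edge (edge i s i→s)))
        where
        short : ∀ {m} → {True (m ℕ.≤? 6)} → m ≤ k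
        short {_} {m≤6} = ℕ.≤-trans (toWitness m≤6) 6≤k
        p≢s : p ≢ s
        p≢s refl = no-return (there p→i (there i→s here)) short
        p′≢s : p′ ≢ s
        p′≢s refl = no-return (there p′→p (there p→i (there i→s here))) short
        i≢s′ : i ≢ s′
        i≢s′ refl = no-return (there i→s (there s→s′ here)) short

      -- No step can delete a cycle vertex while the whole cycle is present, so the run never
      -- reaches the empty set.
      survive : ∀ {S} → SomeRunEmpties (H side F) S → ¬ (∀ i → S (c i) ≡ true)
      survive (done empty) inS with () ← trans (sym (inS zero)) (empty (c zero))
      survive {S} (step v simple run) inS with any? (λ i → c i ≟ v)
      ... | yes (i , refl) = not-simple inS i simple
      ... | no off = survive run λ i → remove⁺ S (inS i) λ ci≡v → off (i , ci≡v)

-- Deleting an edge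

Endpoints : Fin n → Fin n → Fin n → Fin n → Set
Endpoints a b u v = (u ≡ a × v ≡ b) ⊎ (u ≡ b × v ≡ a)

==-refl : (u : Fin n) → (u == u) ≡ true
==-refl u with u ≟ u
... | yes _ = refl
... | no u≢u = contradiction refl u≢u

module _ (E : Adj n) (a b : Fin n) where

  endpoints⇒deleted : ∀ {u v} → Endpoints a b u v → ((u == a ∧ v == b) ∨ (u == b ∧ v == a)) ≡ true
  endpoints⇒deleted (inj₁ (refl , refl)) rewrite ==-refl a | ==-refl b = refl
  endpoints⇒deleted (inj₂ (refl , refl)) rewrite ==-refl a | ==-refl b = Bool.∨-zeroʳ _

  deleteEdge⁻ : ∀ {u v} → deleteEdge E a b u v ≡ true → E u v ≡ true × ¬ Endpoints a b u v
  deleteEdge⁻ {u} {v} eq = Bool.∧-conicalˡ _ _ eq , λ ends →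
    contradiction (trans (sym (cong not (endpoints⇒deleted ends))) (Bool.∧-conicalʳ (E u v) _ eq)) λ ()

  deleteEdge⁺ : ∀ {u v} → E u v ≡ true → ¬ Endpoints a b u v → deleteEdge E a b u v ≡ true
  deleteEdge⁺ {u} {v} e other with u ≟ a | v ≟ b | u ≟ b | v ≟ a
  ... | yes u≡a | yes v≡b | _ | _ = contradiction (inj₁ (u≡a , v≡b)) other
  ... | _ | _ | yes u≡b | yes v≡a = contradiction (inj₂ (u≡b , v≡a)) other
  ... | yes _ | no _ | no _ | _ rewrite e = refl
  ... | yes _ | no _ | yes _ | no _ rewrite e = refl
  ... | no _ | _ | no _ | _ rewrite e = refl
  ... | no _ | _ | yes _ | no _ rewrite e = refl

  deleteEdge-bipartite : ∀ {side} → IsBipartiteGraph side E → IsBipartiteGraph side (deleteEdge E a b)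
  deleteEdge-bipartite ((symmetric , irreflexive) , crossing) =
    ( (λ u v → cong₂ (λ p q → p ∧ not q) (symmetric u v)
        (trans (Bool.∨-comm (u == a ∧ v == b) _) (cong₂ _∨_ (Bool.∧-comm (u == b) _) (Bool.∧-comm (u == a) _))))
    , λ u → cong (_∧ _) (irreflexive u))
    , λ u v e → crossing u v (proj₁ (deleteEdge⁻ e))

module _ (E : Adj n) where

  twoChordal⇒chordal : TwoChordal E → Chordal E
  twoChordal⇒chordal two k c 6≤k cyc with i , j , _ , _ , chord , _ ← two k c 6≤k cyc = i , j , chord

  -- A cycle avoiding the deleted edge is a cycle of `E`. Of its two distinct chords at most one is
  -- the deleted edge, so the other survives.
  twoChordal⇒deleteEdge-chordal : TwoChordal E → ∀ a b → Chordal (deleteEdge E a b)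
  twoChordal⇒deleteEdge-chordal two a b k c 6≤k (3≤k , injective , edge)
    with i , j , i′ , j′ , (i<j , e , ¬edge) , (i′<j′ , e′ , ¬edge′) , distinct
           ← two k c 6≤k (3≤k , injective , λ i j i→j → proj₁ (deleteEdge⁻ E a b (edge i j i→j)))
    with true? (deleteEdge E a b (c i) (c j)) | true? (deleteEdge E a b (c i′) (c j′))
  ... | yes kept | _ = i , j , i<j , kept , ¬edge
  ... | no _ | yes kept = i′ , j′ , i′<j′ , kept , ¬edge′
  ... | no lost | no lost′ = contradiction (deleteEdge⁺ E a b e λ ends →
      lost′ (deleteEdge⁺ E a b e′ λ ends′ → clash ends ends′)) lost
    where
    inj : ∀ {i j a} → c i ≡ a → c j ≡ a → i ≡ j
    inj p q = injective _ _ (trans p (sym q))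
    clash : Endpoints a b (c i) (c j) → Endpoints a b (c i′) (c j′) → ⊥
    clash (inj₁ (p , q)) (inj₁ (p′ , q′)) = distinct (inj p p′ , inj q q′)
    clash (inj₂ (p , q)) (inj₂ (p′ , q′)) = distinct (inj p p′ , inj q q′)
    -- With opposite orientations the index pairs are swapped, against the ordering `i < j` built
    -- into chords.
    clash (inj₁ (p , q)) (inj₂ (p′ , q′)) with refl ← inj p q′ | refl ← inj q p′ = ℕ.<-asym i<j i′<j′
    clash (inj₂ (p , q)) (inj₁ (p′ , q′)) with refl ← inj p q′ | refl ← inj q p′ = ℕ.<-asym i<j i′<j′

  -- A chord is not a cycle edge, so the cycle survives its deletion; chordality of the remaining
  -- graph then yields a second, different chord.
  chordal⇒twoChordal : (∀ u v → E u v ≡ E v u) → Chordal E →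
                       (∀ a b → E a b ≡ true → Chordal (deleteEdge E a b)) → TwoChordal E
  chordal⇒twoChordal symmetric chordal chordal-delete k c 6≤k cyc@(3≤k , injective , edge)
    with i , j , chord@(_ , e , ¬edge) ← chordal k c 6≤k cyc
    with i′ , j′ , i′<j′ , e′ , ¬edge′ ← chordal-delete (c i) (c j) e k c 6≤k (3≤k , injective , λ u v u→v →
           deleteEdge⁺ E (c i) (c j) (edge u v u→v) λ
             { (inj₁ (p , q)) → ¬edge (u , v , u→v , inj₁ (sym p , sym q))
             ; (inj₂ (p , q)) → ¬edge (u , v , u→v , inj₂ (sym q , sym p)) })
    with e″ , other ← deleteEdge⁻ E (c i) (c j) e′ =
    i , j , i′ , j′ , chord , (i′<j′ , e″ , ¬edge′) , λ { (refl , refl) → other (inj₁ (refl , refl)) }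

-- The choice of simple vertices is free. One direction covers every run and the other starts from a
-- single successful run for each graph, so the outcome does not depend on the choices.
theorem3p2 : (n : ℕ) (side : Fin n → Bool) (E : Adj n) →
    IsBipartiteGraph side E →
    (TwoChordal E → ProcTrueAllRuns side E) × (ProcTrueSomeRun side E → TwoChordal E)
theorem3p2 n side E bip =
  (λ two → allRuns E bip (twoChordal⇒chordal E two)
         , λ a b _ → allRuns (deleteEdge E a b) (deleteEdge-bipartite E a b bip) (twoChordal⇒deleteEdge-chordal E two a b))
  , λ (run , runs) → chordal⇒twoChordal E (proj₁ (proj₁ bip)) (eliminable⇒chordal side E bip run)
      λ a b e → eliminable⇒chordal side (deleteEdge E a b) (deleteEdge-bipartite E a b bip) (runs a b e)
  where
  open BipartiteGraph
  allRuns : ∀ F → IsBipartiteGraph side F → Chordal F → AllRunsEmpty (H side F) full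
  allRuns F bip chordal = allRunsEmpty (H side F) (λ S → chordal⇒simpleVertex side F bip S chordal) full
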